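{- For all positive integers $n,k$: $\mathrm{constr}(n,k)\le 4\,\mathrm{opt}(n,k)$, and $\mathrm{constr}(n,k)\le \mathrm{opt}(n+2k,k)$.
   Context: $[n]=\{1,\dots,n\}$. An $(n,k)$-generator is a family $\mathcal G$ of subsets of $[n]$ such that every non-empty subset of $[n]$ is a disjoint union of at most $k$ members of $\mathcal G$. $\mathrm{opt}(n,k)$ is the minimum of $|\mathcal G|$ over all $(n,k)$-generators. With $p=\lceil n/k\rceil$ and $n=pk-r$, $0\le r<k$, define $\mathrm{constr}(n,k):=r(2^{p-1}-1)+(k-r)(2^p-1)$; this is the size of the $(n,k)$-generator consisting of all non-empty subsets of the classes of a partition of $[n]$ into $r$ sets of size $p-1$ and $k-r$ sets of size $p$. -}

module Defs where

open import Data.Bool.Base using (true; false)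
import Data.Bool.Properties as Bool
open import Data.Fin.Subset using (Subset; Nonempty; Empty; _∩_; _∪_; ⋃)
open import Data.Fin.Subset.Properties using (anySubset?; nonempty?; ∪-identityʳ)
open import Data.List.Base using (List; []; _∷_; _++_; map; length)
import Data.List.Membership.DecPropositional as DecMembership
open import Data.List.Membership.Propositional using (_∈_)
open import Data.List.Membership.Propositional.Properties using (∈-++⁺ˡ; ∈-++⁺ʳ; ∈-map⁺; ∈-map⁻)
open import Data.List.Relation.Unary.All as All using (All; []; _∷_)
open import Data.List.Relation.Unary.AllPairs using (AllPairs; []; _∷_; allPairs?)
open import Data.List.Relation.Unary.Any using (here)
open import Data.List.Relation.Unary.Unique.Propositional using (Unique)
import Data.List.Relation.Unary.Unique.Propositional.Properties as Unique
open import Data.Nat.Base using (ℕ; zero; suc; _+_; _*_; _∸_; _^_; _≤_; _<_; z≤n; s≤s; s≤s⁻¹; NonZero; >-nonZero⁻¹)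
open import Data.Nat.DivMod using (_/_; _%_; m/n*n≤m; m%n<n; m≡m%n+[m/n]*n)
import Data.Nat.Properties as ℕ
open import Data.Product.Base using (∃; _×_; _,_; proj₁; proj₂)
open import Data.Sum.Base using (_⊎_; inj₁; inj₂)
import Data.Vec.Base as Vec
import Data.Vec.Properties as Vec
open import Level using (0ℓ)
open import Relation.Binary.Definitions using (DecidableEquality)
open import Relation.Binary.PropositionalEquality using (_≡_; refl)
open import Relation.Nullary.Decidable using (Dec; yes; no; map′; ¬?; _×-dec_; _⊎-dec_; _→-dec_; decidable-stable)
open import Relation.Nullary.Negation using (¬_; contradiction)
open import Relation.Unary using (Pred; Decidable)

-- ⋃ of a list of pairwise disjoint sets. Disjointness already rules out
-- repeated members of L, except for the harmless empty set.
IsDisjointUnion : ∀ {n} → ℕ → List (Subset n) → Subset n → Set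
IsDisjointUnion k G S = ∃ λ L →
  length L ≤ k × All (_∈ G) L × AllPairs (λ A B → Empty (A ∩ B)) L × ⋃ L ≡ S

-- A family of subsets of [n] is a duplicate-free list, so that its
-- cardinality is its length.
IsGenerator : (n k : ℕ) → List (Subset n) → Set
IsGenerator n k G =
  Unique G × (∀ (S : Subset n) → Nonempty S → IsDisjointUnion k G S)

HasGeneratorOfSize : (n k : ℕ) → Pred ℕ 0ℓ
HasGeneratorOfSize n k m = ∃ λ G → IsGenerator n k G × length G ≡ m

IsMinimum : Pred ℕ 0ℓ → Pred ℕ 0ℓ
IsMinimum P m = P m × (∀ j → P j → m ≤ j)

-- The private block shows that the minimum exists, so that opt can be a function.

private
  minimum : ∀ {P : Pred ℕ 0ℓ} → Decidable P → ∀ m → P m → ∃ (IsMinimum P)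
  minimum P? zero p = zero , p , λ _ _ → z≤n
  minimum {P} P? (suc m) p with P? zero
  ... | yes p₀ = zero , p₀ , λ _ _ → z≤n
  ... | no ¬p₀ with minimum {λ j → P (suc j)} (λ j → P? (suc j)) m p
  ...   | l , pl , least = suc l , pl , λ where
            zero    p₀ → contradiction p₀ ¬p₀
            (suc j) pj → s≤s (least j pj)

  _≟_ : ∀ {n} → DecidableEquality (Subset n)
  _≟_ = Vec.≡-dec Bool._≟_

  anyList≤? : ∀ {n} {P : Pred (List (Subset n)) 0ℓ} → Decidable P →
              ∀ k → Dec (∃ λ L → length L ≤ k × P L)
  anyList≤? P? zero = map′
    (λ p → [] , z≤n , p)
    (λ { ([] , _ , p) → p })
    (P? [])
  anyList≤? {P = P} P? (suc k) = map′
    (λ { (inj₁ p) → [] , z≤n , p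
       ; (inj₂ (x , L , le , p)) → x ∷ L , s≤s le , p })
    (λ { ([] , _ , p) → inj₁ p
       ; (x ∷ L , le , p) → inj₂ (x , L , s≤s⁻¹ le , p) })
    (P? [] ⊎-dec anySubset? (λ x → anyList≤? {P = λ L → P (x ∷ L)} (λ L → P? (x ∷ L)) k))

  allSubset? : ∀ {n} {P : Pred (Subset n) 0ℓ} → Decidable P → Dec (∀ S → P S)
  allSubset? P? = map′
    (λ ¬∃¬ S → decidable-stable (P? S) (λ ¬p → ¬∃¬ (S , ¬p)))
    (λ f (S , ¬p) → ¬p (f S))
    (¬? (anySubset? (λ S → ¬? (P? S))))

  isDisjointUnion? : ∀ {n} k (G : List (Subset n)) → Decidable (IsDisjointUnion k G)
  isDisjointUnion? k G S = anyList≤? (λ L →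
    All.all? (λ A → DecMembership._∈?_ _≟_ A G) L
    ×-dec allPairs? (λ A B → ¬? (nonempty? (A ∩ B))) L
    ×-dec (⋃ L ≟ S)) k

  isGenerator? : ∀ n k → Decidable (IsGenerator n k)
  isGenerator? n k G =
    allPairs? (λ A B → ¬? (A ≟ B)) G
    ×-dec allSubset? (λ S → nonempty? S →-dec isDisjointUnion? k G S)

  hasGeneratorOfSize? : ∀ n k → Decidable (HasGeneratorOfSize n k)
  hasGeneratorOfSize? n k m = map′
    (λ (G , _ , g) → G , g)
    (λ (G , g , eq) → G , ℕ.≤-reflexive eq , g , eq)
    (anyList≤? (λ G → isGenerator? n k G ×-dec (length G ℕ.≟ m)) m)

  allSubsets : ∀ n → List (Subset n)
  allSubsets zero = Vec.[] ∷ []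
  allSubsets (suc n) =
    map (true Vec.∷_) (allSubsets n) ++ map (false Vec.∷_) (allSubsets n)

  ∈-allSubsets : ∀ {n} (S : Subset n) → S ∈ allSubsets n
  ∈-allSubsets Vec.[] = here refl
  ∈-allSubsets (true Vec.∷ S) = ∈-++⁺ˡ (∈-map⁺ (true Vec.∷_) (∈-allSubsets S))
  ∈-allSubsets {suc n} (false Vec.∷ S) =
    ∈-++⁺ʳ (map (true Vec.∷_) (allSubsets n)) (∈-map⁺ (false Vec.∷_) (∈-allSubsets S))

  allSubsets-unique : ∀ n → Unique (allSubsets n)
  allSubsets-unique zero = [] ∷ []
  allSubsets-unique (suc n) = Unique.++⁺
    (Unique.map⁺ Vec.∷-injectiveʳ (allSubsets-unique n))
    (Unique.map⁺ Vec.∷-injectiveʳ (allSubsets-unique n))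
    disjoint
    where
    disjoint : ∀ {S} → ¬ (S ∈ map (true Vec.∷_) (allSubsets n)
                          × S ∈ map (false Vec.∷_) (allSubsets n))
    disjoint (p , q) with ∈-map⁻ (true Vec.∷_) p | ∈-map⁻ (false Vec.∷_) q
    ... | _ , _ , refl | _ , _ , ()

  allSubsets-generator : ∀ n k .{{_ : NonZero k}} → IsGenerator n k (allSubsets n)
  allSubsets-generator n k = allSubsets-unique n , λ S _ →
    S ∷ [] , >-nonZero⁻¹ k , ∈-allSubsets S ∷ [] , [] ∷ [] , ∪-identityʳ S

  minimalSize : ∀ n k .{{_ : NonZero k}} → ∃ (IsMinimum (HasGeneratorOfSize n k))
  minimalSize n k = minimum (hasGeneratorOfSize? n k) (length (allSubsets n))
    (allSubsets n , allSubsets-generator n k , refl)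

opt : (n k : ℕ) .{{_ : NonZero k}} → ℕ
opt n k = proj₁ (minimalSize n k)

opt-isMinimum : ∀ n k .{{_ : NonZero k}} → IsMinimum (HasGeneratorOfSize n k) (opt n k)
opt-isMinimum n k = proj₂ (minimalSize n k)

⌈_/_⌉ : (n k : ℕ) .{{_ : NonZero k}} → ℕ
⌈ n / k ⌉ = (n + (k ∸ 1)) / k

-- The r with n = ⌈ n / k ⌉ * k - r; see deficit-spec and deficit<k.
deficit : (n k : ℕ) .{{_ : NonZero k}} → ℕ
deficit n k = ⌈ n / k ⌉ * k ∸ n

-- No subtraction truncates when n is positive: then ⌈ n / k ⌉ ≥ 1.
constr : (n k : ℕ) .{{_ : NonZero k}} → ℕ
constr n k = r * (2 ^ (p ∸ 1) ∸ 1) + (k ∸ r) * (2 ^ p ∸ 1)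
  where
  p = ⌈ n / k ⌉
  r = deficit n k

deficit-spec : ∀ n k .{{_ : NonZero k}} → n + deficit n k ≡ ⌈ n / k ⌉ * k
deficit-spec n k@(suc k-1) = ℕ.m+[n∸m]≡n (ℕ.+-cancelʳ-≤ k-1 n (⌈ n / k ⌉ * k) (begin
  n + k-1                             ≡⟨ m≡m%n+[m/n]*n (n + k-1) k ⟩
  (n + k-1) % k + ⌈ n / k ⌉ * k       ≤⟨ ℕ.+-monoˡ-≤ _ (s≤s⁻¹ (m%n<n (n + k-1) k)) ⟩
  k-1 + ⌈ n / k ⌉ * k                 ≡⟨ ℕ.+-comm k-1 _ ⟩
  ⌈ n / k ⌉ * k + k-1                 ∎))
  where open ℕ.≤-Reasoning

deficit<k : ∀ n k .{{_ : NonZero k}} → deficit n k < k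
deficit<k n k@(suc k-1) = s≤s (ℕ.m≤n+o⇒m∸n≤o (⌈ n / k ⌉ * k) n (m/n*n≤m (n + k-1) k))

{-# OPTIONS --safe #-}

-- A generator of [N] of size m has at least 2 ^ N unions of at most k members,
-- so 2 ^ N ≤ Σ_{i ≤ k} C(m, i); hence N ≤ m and 2 ^ N * k ! ≤ (m + k) ^ k.
-- For N = q k + s with s ≤ k this gives, through k ^ k ≤ 3 ^ k * k ! and
-- 1 + x ≤ (9/8) 2 ^ x for x = s / k in [0,1], the inequality
-- 8 * 2 ^ q * (k + s) ≤ 27 * (m + k). Since constr N k + k = 2 ^ q * (k + s), this
-- yields the bound on opt (n + 2 k, k) (where q grows by 2) and, when q ≥ 4, the
-- factor 4. For q ≤ 3 already constr n k ≤ 4 n.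

module Submission where

open import Data.Fin.Base using (Fin; zero; combine; remQuot)
open import Data.Fin.Properties using (2↔Bool; combine-remQuot; injective⇒≤)
open import Data.Fin.Subset using (Subset; ⊥; _∪_; ⋃)
open import Data.Fin.Subset.Properties using (∪-assoc; ∪-comm; ∪-idem; Empty-unique; nonempty?)
open import Data.List.Base using (List; []; _∷_; _++_; map; length; lookup)
open import Data.List.Membership.Propositional using (_∈_)
open import Data.List.Membership.Propositional.Properties using (∈-++⁺ˡ; ∈-++⁺ʳ; ∈-map⁺)
open import Data.List.Properties using (length-map; length-++)
open import Data.List.Relation.Unary.All using (All; []; _∷_)
open import Data.List.Relation.Unary.Any using (here; there; index)
open import Data.List.Relation.Unary.Any.Properties using (lookup-index)
open import Data.Nat.Base using (ℕ; zero; suc; _+_; _*_; _∸_; _^_; _≤_; _<_; _!; z≤n; s≤s; s≤s⁻¹; NonZero)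
open import Data.Nat.Properties
open import Data.Nat.Tactic.RingSolver using (solve-∀)
open import Data.Product.Base using (∃-syntax; ∃₂; _×_; _,_; proj₁; proj₂)
open import Data.Sum.Base using (_⊎_; inj₁; inj₂)
open import Data.Vec.Base using ([]; _∷_)
open import Data.Vec.Properties using (∷-injective)
open import Defs
open import Function.Base using (_∘_)
open import Function.Bundles using (Inverse; Injection)
open import Function.Properties.Inverse using (Inverse⇒Injection)
open import Relation.Binary.PropositionalEquality using (_≡_; refl; sym; trans; cong; cong₂; subst; module ≡-Reasoning)
open import Relation.Nullary.Decidable using (yes; no)

-- Powers

^-distribʳ-* : ∀ n a b → (a * b) ^ n ≡ a ^ n * b ^ n
^-distribʳ-* zero    a b = refl
^-distribʳ-* (suc n) a b =
  trans (cong (a * b *_) (^-distribʳ-* n a b)) (interchange a b (a ^ n) (b ^ n))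
  where
  interchange : ∀ a b x y → a * b * (x * y) ≡ a * x * (b * y)
  interchange = solve-∀

^-cancelˡ-≤ : ∀ n .{{_ : NonZero n}} {a b} → a ^ n ≤ b ^ n → a ≤ b
^-cancelˡ-≤ n aⁿ≤bⁿ = ≮⇒≥ λ b<a → <⇒≱ (^-monoˡ-< n b<a) aⁿ≤bⁿ

^-cancelʳ-≤ : ∀ b → 1 < b → ∀ {m n} → b ^ m ≤ b ^ n → m ≤ n
^-cancelʳ-≤ b 1<b bᵐ≤bⁿ = ≮⇒≥ λ n<m → <⇒≱ (^-monoʳ-< b 1<b n<m) bᵐ≤bⁿ

-- `0 ^ 0` is 1, so `amgm` can cancel `n ^ n` even when `n` is 0.
n^n≢0 : ∀ n → NonZero (n ^ n)
n^n≢0 zero      = _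
n^n≢0 n@(suc _) = m^n≢0 n n

-- The arithmetic-geometric mean inequality

2ab≤a²+b² : ∀ a b → 2 * (a * b) ≤ a * a + b * b
2ab≤a²+b² a b with ≤-total a b
... | inj₁ a≤b with d , refl ← m≤n⇒∃[o]m+o≡n a≤b =
  subst (2 * (a * (a + d)) ≤_) (eq a d) (m≤m+n _ (d * d))
  where
  eq : ∀ a d → 2 * (a * (a + d)) + d * d ≡ a * a + (a + d) * (a + d)
  eq = solve-∀
... | inj₂ b≤a with d , refl ← m≤n⇒∃[o]m+o≡n b≤a =
  subst (2 * ((b + d) * b) ≤_) (eq b d) (m≤m+n _ (d * d))
  where
  eq : ∀ b d → 2 * ((b + d) * b) + d * d ≡ (b + d) * (b + d) + b * b
  eq = solve-∀

-- The graph of u ↦ u ^ (n + 1) lies above its tangent at v.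
^-tangent : ∀ n u v → suc n * (u * v ^ n) ≤ u ^ suc n + n * v ^ suc n
^-tangent zero    u v = ≤-reflexive (eq u)
  where
  eq : ∀ u → 1 * (u * 1) ≡ u * 1 + 0
  eq = solve-∀
-- Multiplying the induction hypothesis by `u` leaves the cross term `n * (u * (v * w))`. Adding it
-- to both sides first makes the left side a multiple of `2 * (u * v)`.
^-tangent (suc n) u v = +-cancelʳ-≤ (n * (u * (v * w))) _ _ (begin
  (2 + n) * (u * (v * w)) + n * (u * (v * w))  ≡⟨ eq₁ n u v w ⟩
  suc n * w * (2 * (u * v))                    ≤⟨ *-monoʳ-≤ (suc n * w) (2ab≤a²+b² u v) ⟩
  suc n * w * (u * u + v * v)                  ≡⟨ eq₂ n u v w ⟩
  u * (suc n * (u * w)) + suc n * (v * (v * w))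
    ≤⟨ +-monoˡ-≤ _ (*-monoʳ-≤ u (^-tangent n u v)) ⟩
  u * (u ^ suc n + n * (v * w)) + suc n * (v * (v * w))
    ≡⟨ eq₃ n u v w (u ^ suc n) ⟩
  u * u ^ suc n + suc n * (v * (v * w)) + n * (u * (v * w)) ∎)
  where
  open ≤-Reasoning
  w = v ^ n
  eq₁ : ∀ n u v w → (2 + n) * (u * (v * w)) + n * (u * (v * w)) ≡ suc n * w * (2 * (u * v))
  eq₁ = solve-∀
  eq₂ : ∀ n u v w → suc n * w * (u * u + v * v) ≡ u * (suc n * (u * w)) + suc n * (v * (v * w))
  eq₂ = solve-∀
  eq₃ : ∀ n u v w z → u * (z + n * (v * w)) + suc n * (v * (v * w))
                    ≡ u * z + suc n * (v * (v * w)) + n * (u * (v * w))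
  eq₃ = solve-∀

-- Appending the number x to n numbers with sum S.
amgm-step : ∀ n S x → suc n ^ suc n * (x * S ^ n) ≤ n ^ n * (S + x) ^ suc n
amgm-step zero      S x = begin
  1 * (x * 1)        ≡⟨ eq₁ x ⟩
  x                  ≤⟨ m≤n+m x S ⟩
  S + x              ≡⟨ eq₂ (S + x) ⟩
  1 * ((S + x) * 1)  ∎
  where
  open ≤-Reasoning
  eq₁ : ∀ x → 1 * (x * 1) ≡ x
  eq₁ = solve-∀
  eq₂ : ∀ y → y ≡ 1 * (y * 1)
  eq₂ = solve-∀
amgm-step n@(suc _) S x =
  *-cancelˡ-≤ n (+-cancelʳ-≤ (n * (v * V)) _ _ (begin
    n * (suc n ^ suc n * (x * S ^ n)) + n * (v * V)
      ≡⟨ cong (λ z → n * (suc n ^ suc n * (x * S ^ n)) + n * (v * z)) V≡ ⟩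
    n * (suc n ^ suc n * (x * S ^ n)) + n * (v * (suc n ^ n * S ^ n))
      ≡⟨ eq₁ n (suc n ^ n) x S (S ^ n) ⟩
    suc n * (u * (suc n ^ n * S ^ n))
      ≡⟨ cong (λ z → suc n * (u * z)) V≡ ⟨
    suc n * (u * V)
      ≤⟨ ^-tangent n u v ⟩
    u ^ suc n + n * (v * V)
      ≡⟨ cong (_+ n * (v * V)) (^-distribʳ-* (suc n) n (S + x)) ⟩
    n * n ^ n * (S + x) ^ suc n + n * (v * V)
      ≡⟨ cong (_+ n * (v * V)) (*-assoc n (n ^ n) _) ⟩
    n * (n ^ n * (S + x) ^ suc n) + n * (v * V) ∎))
  where
  open ≤-Reasoning
  -- `u` and `v` are the new and the old mean, both multiplied by `n * suc n` to clear denominators.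
  u = n * (S + x)
  v = suc n * S
  V = v ^ n
  V≡ : V ≡ suc n ^ n * S ^ n
  V≡ = ^-distribʳ-* n (suc n) S
  eq₁ : ∀ n y x S z → n * (suc n * y * (x * z)) + n * (suc n * S * (y * z))
                    ≡ suc n * (n * (S + x) * (y * z))
  eq₁ = solve-∀

-- Equality holds for copies of `a` alone; each copy of `b` is then appended by `amgm-step`.
amgm : ∀ q p a b → (q + p) ^ (q + p) * (a ^ p * b ^ q) ≤ (p * a + q * b) ^ (q + p)
amgm zero    p a b = ≤-reflexive (begin
  p ^ p * (a ^ p * 1)  ≡⟨ cong (p ^ p *_) (*-identityʳ (a ^ p)) ⟩
  p ^ p * a ^ p        ≡⟨ ^-distribʳ-* p p a ⟨
  (p * a) ^ p          ≡⟨ cong (_^ p) (+-identityʳ (p * a)) ⟨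
  (p * a + 0) ^ p      ∎)
  where open ≡-Reasoning
amgm (suc q) p a b = *-cancelˡ-≤ (n ^ n) {{n^n≢0 n}} (begin
  n ^ n * (suc n ^ suc n * (a ^ p * (b * b ^ q)))  ≡⟨ eq (n ^ n) (suc n ^ suc n) (a ^ p) b (b ^ q) ⟩
  suc n ^ suc n * (b * (n ^ n * (a ^ p * b ^ q)))  ≤⟨ *-monoʳ-≤ (suc n ^ suc n) (*-monoʳ-≤ b (amgm q p a b)) ⟩
  suc n ^ suc n * (b * S ^ n)                      ≤⟨ amgm-step n S b ⟩
  n ^ n * (S + b) ^ suc n                          ≡⟨ cong (λ z → n ^ n * z ^ suc n) (eqS (p * a) (q * b) b) ⟩
  n ^ n * (p * a + suc q * b) ^ suc n              ∎)
  where
  open ≤-Reasoning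
  n = q + p
  S = p * a + q * b
  eq : ∀ x y z b w → x * (y * (z * (b * w))) ≡ y * (b * (x * (z * w)))
  eq = solve-∀
  eqS : ∀ x y b → x + y + b ≡ x + (b + y)
  eqS = solve-∀

-- The fraction `d / c` is the mean of the `q + p` numbers, so that a mean such as 3/2 can be used
-- without division.
amgm-mean : ∀ q p a b c d → c * (p * a + q * b) ≡ (q + p) * d →
            c ^ (q + p) * (a ^ p * b ^ q) ≤ d ^ (q + p)
amgm-mean q p a b c d mean = *-cancelˡ-≤ (n ^ n) {{n^n≢0 n}} (begin
  n ^ n * (c ^ n * (a ^ p * b ^ q))  ≡⟨ eq (n ^ n) (c ^ n) (a ^ p * b ^ q) ⟩
  c ^ n * (n ^ n * (a ^ p * b ^ q))  ≤⟨ *-monoʳ-≤ (c ^ n) (amgm q p a b) ⟩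
  c ^ n * (p * a + q * b) ^ n        ≡⟨ ^-distribʳ-* n c _ ⟨
  (c * (p * a + q * b)) ^ n          ≡⟨ cong (_^ n) mean ⟩
  (n * d) ^ n                        ≡⟨ ^-distribʳ-* n n d ⟩
  n ^ n * d ^ n                      ∎)
  where
  open ≤-Reasoning
  n = q + p
  eq : ∀ x y z → x * (y * z) ≡ y * (x * z)
  eq = solve-∀

-- Here x = s / k ≤ 1/2, and the mean of k copies of 1 + x and d copies of 2 is 3/2.
1+x≤9/8*2^x-low : ∀ s d k .{{_ : NonZero k}} → s + (s + d) ≡ k →
                  8 ^ k * (k + s) ^ k ≤ 9 ^ k * (k ^ k * 2 ^ s)
1+x≤9/8*2^x-low s d k k≡ = begin
  8 ^ k * X                            ≡⟨ cong (_* X) 8ᵏ≡ ⟩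
  -- 72 = 18 * 4: the 4 completes the `4 ^ t` needed for `H`, and 18 = 9 * 2 supplies the missing
  -- `9 ^ s` and the `2 ^ s` of the goal.
  64 ^ s * 8 ^ d * X                   ≤⟨ *-monoˡ-≤ X (*-monoˡ-≤ (8 ^ d) (^-monoˡ-≤ s (m≤m+n 64 8))) ⟩
  72 ^ s * 8 ^ d * X                   ≡⟨ cong (_* X) (cong₂ _*_ (^-distribʳ-* s 18 4) (^-distribʳ-* d 4 2)) ⟩
  18 ^ s * 4 ^ s * (4 ^ d * 2 ^ d) * X ≡⟨ eq₁ (18 ^ s) (4 ^ s) (4 ^ d) (2 ^ d) X ⟩
  18 ^ s * (4 ^ s * 4 ^ d * (X * 2 ^ d)) ≡⟨ cong (λ z → 18 ^ s * (z * (X * 2 ^ d))) (^-distribˡ-+-* 4 s d) ⟨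
  18 ^ s * (4 ^ t * (X * 2 ^ d))       ≤⟨ *-monoʳ-≤ (18 ^ s) H ⟩
  18 ^ s * (9 ^ t * k ^ k)             ≡⟨ cong (_* (9 ^ t * k ^ k)) (^-distribʳ-* s 9 2) ⟩
  9 ^ s * 2 ^ s * (9 ^ t * k ^ k)      ≡⟨ eq₂ (9 ^ s) (2 ^ s) (9 ^ t) (k ^ k) ⟩
  9 ^ s * 9 ^ t * (k ^ k * 2 ^ s)      ≡⟨ cong (_* (k ^ k * 2 ^ s)) (^-distribˡ-+-* 9 s t) ⟨
  9 ^ (s + t) * (k ^ k * 2 ^ s)        ≡⟨ cong (λ z → 9 ^ z * (k ^ k * 2 ^ s)) k≡ ⟩
  9 ^ k * (k ^ k * 2 ^ s)              ∎
  where
  open ≤-Reasoning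
  X = (k + s) ^ k
  t = s + d
  eq₁ : ∀ a b c d x → a * b * (c * d) * x ≡ a * (b * c * (x * d))
  eq₁ = solve-∀
  eq₂ : ∀ a b c d → a * b * (c * d) ≡ a * c * (d * b)
  eq₂ = solve-∀
  8ᵏ≡ : 8 ^ k ≡ 64 ^ s * 8 ^ d
  8ᵏ≡ = trans (cong (8 ^_) (trans (sym k≡) (eq s d)))
          (trans (^-distribˡ-+-* 8 (2 * s) d) (cong (_* 8 ^ d) (sym (^-*-assoc 8 2 s))))
    where
    eq : ∀ s d → s + (s + d) ≡ 2 * s + d
    eq = solve-∀
  d+k≡ : d + k ≡ 2 * t
  d+k≡ = trans (cong (d +_) (sym k≡)) (eq s d)
    where
    eq : ∀ s d → d + (s + (s + d)) ≡ 2 * (s + d)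
    eq = solve-∀
  mean : 2 * (k * (k + s) + d * (2 * k)) ≡ (d + k) * (3 * k)
  mean = subst (λ k → 2 * (k * (k + s) + d * (2 * k)) ≡ (d + k) * (3 * k)) k≡ (eq s d)
    where
    eq : ∀ s d → 2 * ((s + (s + d)) * ((s + (s + d)) + s) + d * (2 * (s + (s + d))))
               ≡ (d + (s + (s + d))) * (3 * (s + (s + d)))
    eq = solve-∀
  H : 4 ^ t * (X * 2 ^ d) ≤ 9 ^ t * k ^ k
  -- All numbers are scaled by `k`, so the `d` padding copies of 2 become `2 * k` and bring in the
  -- cancelled factor `k ^ d`.
  H = *-cancelʳ-≤ _ _ (k ^ d) {{m^n≢0 k d}} (begin
    4 ^ t * (X * 2 ^ d) * k ^ d     ≡⟨ eq₃ (4 ^ t) X (2 ^ d) (k ^ d) ⟩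
    4 ^ t * (X * (2 ^ d * k ^ d))   ≡⟨ cong₂ (λ y z → y * (X * z)) (^-*-assoc 2 2 t) (sym (^-distribʳ-* d 2 k)) ⟩
    2 ^ (2 * t) * (X * (2 * k) ^ d) ≡⟨ cong (λ z → 2 ^ z * (X * (2 * k) ^ d)) d+k≡ ⟨
    2 ^ (d + k) * (X * (2 * k) ^ d) ≤⟨ amgm-mean d k (k + s) (2 * k) 2 (3 * k) mean ⟩
    (3 * k) ^ (d + k)               ≡⟨ ^-distribʳ-* (d + k) 3 k ⟩
    3 ^ (d + k) * k ^ (d + k)       ≡⟨ cong₂ _*_ (trans (cong (3 ^_) d+k≡) (sym (^-*-assoc 3 2 t))) (^-distribˡ-+-* k d k) ⟩
    9 ^ t * (k ^ d * k ^ k)         ≡⟨ eq₄ (9 ^ t) (k ^ d) (k ^ k) ⟩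
    9 ^ t * k ^ k * k ^ d           ∎)
    where
    eq₃ : ∀ a b c d → a * (b * c) * d ≡ a * (b * (c * d))
    eq₃ = solve-∀
    eq₄ : ∀ a b c → a * (b * c) ≡ a * c * b
    eq₄ = solve-∀

-- Here x = s / k ≥ 1/2, and the mean of k copies of 1 + x and d copies of 1 is 3/2.
1+x≤9/8*2^x-high : ∀ t d k .{{_ : NonZero k}} → (t + d) + t ≡ k →
                   8 ^ k * (k + (t + d)) ^ k ≤ 9 ^ k * (k ^ k * 2 ^ (t + d))
1+x≤9/8*2^x-high t d k k≡ = begin
  8 ^ k * X                       ≡⟨ cong (λ z → 8 ^ z * X) k≡ ⟨
  8 ^ (s + t) * X                 ≡⟨ cong (_* X) (^-distribˡ-+-* 8 s t) ⟩
  8 ^ s * 8 ^ t * X               ≤⟨ *-monoˡ-≤ X (*-monoʳ-≤ (8 ^ s) (^-monoˡ-≤ t (n≤1+n 8))) ⟩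
  8 ^ s * 9 ^ t * X               ≡⟨ cong (λ z → z * 9 ^ t * X) (^-distribʳ-* s 2 4) ⟩
  2 ^ s * 4 ^ s * 9 ^ t * X       ≡⟨ eq₁ (2 ^ s) (4 ^ s) (9 ^ t) X ⟩
  2 ^ s * 9 ^ t * (4 ^ s * X)     ≤⟨ *-monoʳ-≤ (2 ^ s * 9 ^ t) H ⟩
  2 ^ s * 9 ^ t * (9 ^ s * k ^ k) ≡⟨ eq₂ (2 ^ s) (9 ^ t) (9 ^ s) (k ^ k) ⟩
  9 ^ s * 9 ^ t * (k ^ k * 2 ^ s) ≡⟨ cong (_* (k ^ k * 2 ^ s)) (^-distribˡ-+-* 9 s t) ⟨
  9 ^ (s + t) * (k ^ k * 2 ^ s)   ≡⟨ cong (λ z → 9 ^ z * (k ^ k * 2 ^ s)) k≡ ⟩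
  9 ^ k * (k ^ k * 2 ^ s)         ∎
  where
  open ≤-Reasoning
  s = t + d
  X = (k + s) ^ k
  eq₁ : ∀ a b c x → a * b * c * x ≡ a * c * (b * x)
  eq₁ = solve-∀
  eq₂ : ∀ a b c d → a * b * (c * d) ≡ c * b * (d * a)
  eq₂ = solve-∀
  d+k≡ : d + k ≡ 2 * s
  d+k≡ = trans (cong (d +_) (sym k≡)) (eq t d)
    where
    eq : ∀ t d → d + ((t + d) + t) ≡ 2 * (t + d)
    eq = solve-∀
  mean : 2 * (k * (k + s) + d * k) ≡ (d + k) * (3 * k)
  mean = subst (λ k → 2 * (k * (k + s) + d * k) ≡ (d + k) * (3 * k)) k≡ (eq t d)
    where
    eq : ∀ t d → 2 * (((t + d) + t) * (((t + d) + t) + (t + d)) + d * ((t + d) + t))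
               ≡ (d + ((t + d) + t)) * (3 * ((t + d) + t))
    eq = solve-∀
  H : 4 ^ s * X ≤ 9 ^ s * k ^ k
  H = *-cancelʳ-≤ _ _ (k ^ d) {{m^n≢0 k d}} (begin
    4 ^ s * X * k ^ d           ≡⟨ *-assoc (4 ^ s) X (k ^ d) ⟩
    4 ^ s * (X * k ^ d)         ≡⟨ cong (_* (X * k ^ d)) (^-*-assoc 2 2 s) ⟩
    2 ^ (2 * s) * (X * k ^ d)   ≡⟨ cong (λ z → 2 ^ z * (X * k ^ d)) d+k≡ ⟨
    2 ^ (d + k) * (X * k ^ d)   ≤⟨ amgm-mean d k (k + s) k 2 (3 * k) mean ⟩
    (3 * k) ^ (d + k)           ≡⟨ ^-distribʳ-* (d + k) 3 k ⟩
    3 ^ (d + k) * k ^ (d + k)   ≡⟨ cong₂ _*_ (trans (cong (3 ^_) d+k≡) (sym (^-*-assoc 3 2 s))) (^-distribˡ-+-* k d k) ⟩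
    9 ^ s * (k ^ d * k ^ k)     ≡⟨ eq₃ (9 ^ s) (k ^ d) (k ^ k) ⟩
    9 ^ s * k ^ k * k ^ d       ∎)
    where
    eq₃ : ∀ a b c → a * (b * c) ≡ a * c * b
    eq₃ = solve-∀

-- 1 + x ≤ (9/8) 2 ^ x at x = s / k, raised to the power k.
1+x≤9/8*2^x : ∀ k .{{_ : NonZero k}} {s} → s ≤ k →
              8 ^ k * (k + s) ^ k ≤ 9 ^ k * (k ^ k * 2 ^ s)
1+x≤9/8*2^x k {s} s≤k with t , s+t≡k ← m≤n⇒∃[o]m+o≡n s≤k | ≤-total s t
... | inj₁ s≤t with d , refl ← m≤n⇒∃[o]m+o≡n s≤t = 1+x≤9/8*2^x-low s d k s+t≡k
... | inj₂ t≤s with d , refl ← m≤n⇒∃[o]m+o≡n t≤s = 1+x≤9/8*2^x-high t d k s+t≡k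

-- Factorials

-- (1 + 1/k) ^ j ≤ 1 + j/k + (j/k)²
[1+1/k]^j≤ : ∀ k j → j ≤ k → k * k * suc k ^ j ≤ k ^ j * (k * k + j * k + j * j)
[1+1/k]^j≤ k zero    _ = ≤-reflexive (eq k)
  where
  eq : ∀ k → k * k * 1 ≡ 1 * (k * k + 0 * k + 0 * 0)
  eq = solve-∀
[1+1/k]^j≤ k (suc j) j<k = begin
  k * k * (suc k * suc k ^ j)                     ≡⟨ eq₁ k (suc k ^ j) ⟩
  suc k * (k * k * suc k ^ j)                     ≤⟨ *-monoʳ-≤ (suc k) ([1+1/k]^j≤ k j (<⇒≤ j<k)) ⟩
  suc k * (k ^ j * (k * k + j * k + j * j))       ≡⟨ eq₂ k j (k ^ j) ⟩
  k ^ j * (k * (k * k + j * k + j * j + k + j) + j * j)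
    -- Since `j < k`, the surplus `j * j` is at most `k * suc j`, exactly the room left in the bound
    -- for `suc j`.
    ≤⟨ *-monoʳ-≤ (k ^ j) (+-monoʳ-≤ _ (*-mono-≤ (<⇒≤ j<k) (n≤1+n j))) ⟩
  k ^ j * (k * (k * k + j * k + j * j + k + j) + k * suc j)
    ≡⟨ eq₃ k j (k ^ j) ⟩
  k * k ^ j * (k * k + suc j * k + suc j * suc j) ∎
  where
  open ≤-Reasoning
  eq₁ : ∀ k x → k * k * (suc k * x) ≡ suc k * (k * k * x)
  eq₁ = solve-∀
  eq₂ : ∀ k j x → suc k * (x * (k * k + j * k + j * j))
                ≡ x * (k * (k * k + j * k + j * j + k + j) + j * j)
  eq₂ = solve-∀
  eq₃ : ∀ k j x → x * (k * (k * k + j * k + j * j + k + j) + k * suc j)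
                ≡ k * x * (k * k + suc j * k + suc j * suc j)
  eq₃ = solve-∀

[1+k]^k≤3*k^k : ∀ k → suc k ^ k ≤ 3 * k ^ k
[1+k]^k≤3*k^k zero      = s≤s z≤n
[1+k]^k≤3*k^k k@(suc _) = *-cancelˡ-≤ (k * k)
  (≤-trans ([1+1/k]^j≤ k k ≤-refl) (≤-reflexive (eq k (k ^ k))))
  where
  eq : ∀ k x → x * (k * k + k * k + k * k) ≡ k * k * (3 * x)
  eq = solve-∀

-- Passing from `k` to `suc k` multiplies `k ^ k / k !` by `(1 + 1/k) ^ k`, which is at most 3.
k^k≤3^k*k! : ∀ k → k ^ k ≤ 3 ^ k * k !
k^k≤3^k*k! zero    = ≤-refl
k^k≤3^k*k! (suc k) = begin
  suc k * suc k ^ k           ≤⟨ *-monoʳ-≤ (suc k) ([1+k]^k≤3*k^k k) ⟩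
  suc k * (3 * k ^ k)         ≤⟨ *-monoʳ-≤ (suc k) (*-monoʳ-≤ 3 (k^k≤3^k*k! k)) ⟩
  suc k * (3 * (3 ^ k * k !)) ≡⟨ eq (suc k) (3 ^ k) (k !) ⟩
  3 * 3 ^ k * (suc k * k !)   ∎
  where
  open ≤-Reasoning
  eq : ∀ a b c → a * (3 * (b * c)) ≡ 3 * b * (a * c)
  eq = solve-∀

k!≤k^k : ∀ k → k ! ≤ k ^ k
k!≤k^k zero    = ≤-refl
k!≤k^k (suc k) = *-monoʳ-≤ (suc k) (≤-trans (k!≤k^k k) (^-monoˡ-≤ k (n≤1+n k)))

-- These are the two leading terms of the binomial expansion; they match Pascal's rule in
-- `k!*length-unions≤`.
bernoulli : ∀ k x → x ^ suc k + suc k * x ^ k ≤ suc x ^ suc k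
bernoulli zero    x = ≤-reflexive (eq x)
  where
  eq : ∀ x → x * 1 + 1 * 1 ≡ suc x * 1
  eq = solve-∀
bernoulli (suc k) x = begin
  x * (x * x ^ k) + (2 + k) * (x * x ^ k)          ≤⟨ m≤m+n _ (suc k * x ^ k) ⟩
  x * (x * x ^ k) + (2 + k) * (x * x ^ k) + suc k * x ^ k
    ≡⟨ eq k x (x ^ k) ⟩
  suc x * (x * x ^ k + suc k * x ^ k)              ≤⟨ *-monoʳ-≤ (suc x) (bernoulli k x) ⟩
  suc x * suc x ^ suc k                            ∎
  where
  open ≤-Reasoning
  eq : ∀ k x y → x * (x * y) + (2 + k) * (x * y) + suc k * y ≡ suc x * (x * y + suc k * y)
  eq = solve-∀

-- Unions of at most k members of a family

-- The recursion is Pascal's rule, splitting on whether `g` is used, so for `m` sets the length is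
-- Σ_{i ≤ k} C(m, i). Equal unions are listed repeatedly, which is harmless for an upper bound.
unions : ∀ {n} → ℕ → List (Subset n) → List (Subset n)
unions zero    G       = ⊥ ∷ []
unions (suc k) []      = ⊥ ∷ []
unions (suc k) (g ∷ G) = unions (suc k) G ++ map (g ∪_) (unions k G)

length-unions-∷ : ∀ {n} k g (G : List (Subset n)) →
                  length (unions (suc k) (g ∷ G)) ≡ length (unions (suc k) G) + length (unions k G)
length-unions-∷ k g G = trans (length-++ (unions (suc k) G))
  (cong (length (unions (suc k) G) +_) (length-map (g ∪_) (unions k G)))

length-unions≤2^ : ∀ {n} k (G : List (Subset n)) → length (unions k G) ≤ 2 ^ length G
length-unions≤2^ zero    G       = m^n>0 2 (length G)
length-unions≤2^ (suc k) []      = ≤-refl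
length-unions≤2^ (suc k) (g ∷ G) rewrite length-unions-∷ k g G =
  +-mono-≤ (length-unions≤2^ (suc k) G)
    (≤-trans (length-unions≤2^ k G) (≤-reflexive (sym (+-identityʳ (2 ^ length G)))))

k!*length-unions≤ : ∀ {n} k (G : List (Subset n)) →
                    k ! * length (unions k G) ≤ (length G + k) ^ k
k!*length-unions≤ zero    G       = ≤-refl
k!*length-unions≤ (suc k) []      =
  ≤-trans (≤-reflexive (*-identityʳ (suc k !))) (k!≤k^k (suc k))
k!*length-unions≤ (suc k) (g ∷ G) rewrite length-unions-∷ k g G = begin
  suc k ! * (a + b)               ≡⟨ eq (suc k) (k !) a b ⟩
  suc k ! * a + suc k * (k ! * b) ≤⟨ +-mono-≤ (k!*length-unions≤ (suc k) G)
                                       (*-monoʳ-≤ (suc k) (k!*length-unions≤ k G)) ⟩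
  (m + suc k) ^ suc k + suc k * (m + k) ^ k
    -- Both powers get the base `m + suc k`, as `bernoulli` requires.
    ≤⟨ +-monoʳ-≤ ((m + suc k) ^ suc k) (*-monoʳ-≤ (suc k) (^-monoˡ-≤ k (+-monoʳ-≤ m (n≤1+n k)))) ⟩
  (m + suc k) ^ suc k + suc k * (m + suc k) ^ k
    ≤⟨ bernoulli k (m + suc k) ⟩
  suc (m + suc k) ^ suc k         ∎
  where
  open ≤-Reasoning
  a = length (unions (suc k) G)
  b = length (unions k G)
  m = length G
  eq : ∀ k f a b → k * f * (a + b) ≡ k * f * a + k * (f * b)
  eq = solve-∀

⊥∈unions : ∀ {n} k (G : List (Subset n)) → ⊥ ∈ unions k G
⊥∈unions zero    G       = here refl
⊥∈unions (suc k) []      = here refl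
⊥∈unions (suc k) (g ∷ G) = ∈-++⁺ˡ (⊥∈unions (suc k) G)

-- The two outcomes are the two halves of `unions`. Repeated copies of `g` in `L` are merged by
-- idempotence, so removing them all costs a single `g` and shortens the list.
extractHead : ∀ {n g} {G : List (Subset n)} L → All (_∈ g ∷ G) L →
              All (_∈ G) L ⊎ (∃[ L′ ] All (_∈ G) L′ × length L′ < length L × ⋃ L ≡ g ∪ ⋃ L′)
extractHead []      [] = inj₁ []
extractHead (x ∷ L) (x∈ ∷ L⊆) with x∈ | extractHead L L⊆
... | here refl | inj₁ L⊆G                  = inj₂ (L , L⊆G , ≤-refl , refl)
... | here refl | inj₂ (L′ , L′⊆ , lt , eq) = inj₂ (L′ , L′⊆ , m<n⇒m<1+n lt ,
  trans (cong (x ∪_) eq)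
    (trans (sym (∪-assoc x x (⋃ L′))) (cong (_∪ ⋃ L′) (∪-idem x))))
... | there x∈G | inj₁ L⊆G                  = inj₁ (x∈G ∷ L⊆G)
extractHead {g = g} (x ∷ L) _ | there x∈G | inj₂ (L′ , L′⊆ , lt , eq) =
  inj₂ (x ∷ L′ , x∈G ∷ L′⊆ , s≤s lt ,
    trans (cong (x ∪_) eq)
      (trans (sym (∪-assoc x g (⋃ L′)))
        (trans (cong (_∪ ⋃ L′) (∪-comm x g)) (∪-assoc g x (⋃ L′)))))

⋃∈unions : ∀ {n} k (G : List (Subset n)) L → All (_∈ G) L → length L ≤ k → ⋃ L ∈ unions k G
⋃∈unions k       G       []      _        _  = ⊥∈unions k G
⋃∈unions (suc k) []      (_ ∷ _) (() ∷ _) _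
⋃∈unions (suc k) (g ∷ G) L@(_ ∷ _) L⊆     le with extractHead L L⊆
... | inj₁ L⊆G                  = ∈-++⁺ˡ (⋃∈unions (suc k) G L L⊆G le)
... | inj₂ (L′ , L′⊆ , lt , eq) = subst (_∈ unions (suc k) (g ∷ G)) (sym eq)
  (∈-++⁺ʳ (unions (suc k) G)
    (∈-map⁺ (g ∪_) (⋃∈unions k G L′ L′⊆ (s≤s⁻¹ (≤-trans lt le)))))

-- Counting the subsets of [n]

-- Binary digits, leading digit first; only injectivity is used for the count.
fromCode : ∀ n → Fin (2 ^ n) → Subset n
fromCode zero    _ = []
fromCode (suc n) i = Inverse.to 2↔Bool (proj₁ bj) ∷ fromCode n (proj₂ bj)
  where bj = remQuot {2} (2 ^ n) i

fromCode-injective : ∀ n {i j} → fromCode n i ≡ fromCode n j → i ≡ j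
fromCode-injective zero    {zero} {zero} _ = refl
fromCode-injective (suc n) {i}    {j}    eq with b , rest ← ∷-injective eq =
  trans (sym (combine-remQuot {2} (2 ^ n) i))
    (trans (cong₂ (combine {2} {2 ^ n})
             (Injection.injective (Inverse⇒Injection 2↔Bool) b) (fromCode-injective n rest))
      (combine-remQuot {2} (2 ^ n) j))

-- Mapping a code to the position of its subset in `xs` is injective, since the entry at that
-- position recovers the subset.
2^n≤length : ∀ {n} (xs : List (Subset n)) → (∀ S → S ∈ xs) → 2 ^ n ≤ length xs
2^n≤length {n} xs all∈ = injective⇒≤ {f = index ∘ all∈ ∘ fromCode n} λ {i} {j} eq →
  fromCode-injective n
    (trans (lookup-index (all∈ (fromCode n i)))
      (trans (cong (lookup xs) eq) (sym (lookup-index (all∈ (fromCode n j))))))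

-- Lower bounds on the size of a generator

module _ {N k : ℕ} {G : List (Subset N)} (gen : IsGenerator N k G) where

  2^N≤length-unions : 2 ^ N ≤ length (unions k G)
  2^N≤length-unions = 2^n≤length (unions k G) go
    where
    go : ∀ S → S ∈ unions k G
    go S with nonempty? S
    -- The generator property concerns non-empty sets only; the empty set is the union of no
    -- members.
    ... | no empty = subst (_∈ unions k G) (sym (Empty-unique empty)) (⊥∈unions k G)
    ... | yes ne with L , le , L⊆G , _ , refl ← proj₂ gen S ne = ⋃∈unions k G L L⊆G le

  generator-length≥ : N ≤ length G
  generator-length≥ = ^-cancelʳ-≤ 2 ≤-refl (≤-trans 2^N≤length-unions (length-unions≤2^ k G))

  generator-k!*2^≤ : k ! * 2 ^ N ≤ (length G + k) ^ k
  generator-k!*2^≤ = ≤-trans (*-monoʳ-≤ (k !) 2^N≤length-unions) (k!*length-unions≤ k G)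

n≤opt : ∀ n k .{{_ : NonZero k}} → n ≤ opt n k
n≤opt n k with (G , gen , eq) , _ ← opt-isMinimum n k = subst (n ≤_) eq (generator-length≥ gen)

k!*2^n≤ : ∀ n k .{{_ : NonZero k}} → k ! * 2 ^ n ≤ (opt n k + k) ^ k
k!*2^n≤ n k with (G , gen , eq) , _ ← opt-isMinimum n k =
  subst (λ m → k ! * 2 ^ n ≤ (m + k) ^ k) eq (generator-k!*2^≤ gen)

-- Comparison with the construction

-- The `k`-th powers are compared, using that `2 ^ n` is `(2 ^ q) ^ k * 2 ^ s`. The constant is 27/8
-- = 3 * 9/8, with 3 from `k^k≤3^k*k!` and 9/8 from `1+x≤9/8*2^x`.
8*2^q*[k+s]≤27*[opt+k] : ∀ n k .{{_ : NonZero k}} q {s} → s ≤ k → n ≡ q * k + s →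
                          8 * (2 ^ q * (k + s)) ≤ 27 * (opt n k + k)
8*2^q*[k+s]≤27*[opt+k] n k q {s} s≤k refl = ^-cancelˡ-≤ k (begin
  (8 * (Q * (k + s))) ^ k               ≡⟨ ^-distribʳ-* k 8 _ ⟩
  8 ^ k * (Q * (k + s)) ^ k             ≡⟨ cong (8 ^ k *_) (^-distribʳ-* k Q (k + s)) ⟩
  8 ^ k * (Q ^ k * (k + s) ^ k)         ≡⟨ eq₁ (8 ^ k) (Q ^ k) _ ⟩
  Q ^ k * (8 ^ k * (k + s) ^ k)         ≤⟨ *-monoʳ-≤ (Q ^ k) (1+x≤9/8*2^x k s≤k) ⟩
  Q ^ k * (9 ^ k * (k ^ k * 2 ^ s))     ≤⟨ *-monoʳ-≤ (Q ^ k) (*-monoʳ-≤ (9 ^ k) (*-monoˡ-≤ (2 ^ s) (k^k≤3^k*k! k))) ⟩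
  Q ^ k * (9 ^ k * (3 ^ k * k ! * 2 ^ s))
    ≡⟨ eq₂ (Q ^ k) (9 ^ k) (3 ^ k) (k !) (2 ^ s) ⟩
  9 ^ k * 3 ^ k * (k ! * (Q ^ k * 2 ^ s))
    ≡⟨ cong₂ (λ x y → x * (k ! * y)) (^-distribʳ-* k 9 3)
         (trans (^-distribˡ-+-* 2 (q * k) s) (cong (_* 2 ^ s) (sym (^-*-assoc 2 q k)))) ⟨
  27 ^ k * (k ! * 2 ^ n)                ≤⟨ *-monoʳ-≤ (27 ^ k) (k!*2^n≤ n k) ⟩
  27 ^ k * (opt n k + k) ^ k            ≡⟨ ^-distribʳ-* k 27 _ ⟨
  (27 * (opt n k + k)) ^ k              ∎)
  where
  open ≤-Reasoning
  Q = 2 ^ q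
  eq₁ : ∀ a b c → a * (b * c) ≡ b * (a * c)
  eq₁ = solve-∀
  eq₂ : ∀ a b c d e → a * (b * (c * d * e)) ≡ b * c * (d * (a * e))
  eq₂ = solve-∀

-- There are `r` classes of size `q` and `s = k - r` of size `q + 1`. Adding `k` restores the empty
-- set of each class, giving `r * 2 ^ q + s * 2 ^ (q + 1)`. For `r = 0` this has `s = k`, so `s` is
-- not the remainder of `n` modulo `k`.
constr-form : ∀ n k .{{_ : NonZero n}} .{{_ : NonZero k}} →
              ∃₂ λ q s → s ≤ k × n ≡ q * k + s × constr n k + k ≡ 2 ^ q * (k + s)
constr-form n@(suc _) k =
  go ⌈ n / k ⌉ (deficit n k) (deficit-spec n k) (<⇒≤ (deficit<k n k))
  where
  go : ∀ p r → n + r ≡ p * k → r ≤ k →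
       ∃₂ λ q s → s ≤ k × n ≡ q * k + s ×
         r * (2 ^ (p ∸ 1) ∸ 1) + (k ∸ r) * (2 ^ p ∸ 1) + k ≡ 2 ^ q * (k + s)
  go (suc q) r spec r≤k = q , k ∸ r , m∸n≤m k r , n≡ , size
    where
    n≡ : n ≡ q * k + (k ∸ r)
    n≡ = +-cancelʳ-≡ r n _ (trans spec (trans (+-comm k (q * k))
           (trans (cong (q * k +_) (sym (m∸n+n≡m r≤k))) (sym (+-assoc (q * k) (k ∸ r) r)))))
    eq : ∀ r s a → r * a + s * (a + suc (a + 0)) + (r + s) ≡ suc a * (r + s + s)
    eq = solve-∀
    size : r * (2 ^ q ∸ 1) + (k ∸ r) * (2 ^ suc q ∸ 1) + k ≡ 2 ^ q * (k + (k ∸ r))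
    -- Writing `2 ^ q` as `suc a` removes the truncated subtractions.
    size with 2 ^ q | m^n>0 2 q
    ... | suc a | _ = subst (λ z → r * a + (k ∸ r) * (a + suc (a + 0)) + z ≡ suc a * (z + (k ∸ r)))
                        (m+[n∸m]≡n r≤k) (eq r (k ∸ r) a)

-- With `k = s + t` the difference of the sides is a linear form in `s` and `t` with non-negative
-- coefficients. At `q = 4` the inequality fails for `s = k > 0`.
2^q*[k+s]≤4*[qk+s]+k : ∀ q → q ≤ 3 → ∀ k s → s ≤ k →
                        2 ^ q * (k + s) ≤ 4 * (q * k + s) + k
2^q*[k+s]≤4*[qk+s]+k q q≤3 k s s≤k with t , refl ← m≤n⇒∃[o]m+o≡n s≤k = go q q≤3
  where
  le : ∀ {x y} d → x + d ≡ y → x ≤ y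
  le d refl = m≤m+n _ d
  go : ∀ q → q ≤ 3 → 2 ^ q * (s + t + s) ≤ 4 * (q * (s + t) + s) + (s + t)
  go 0 _ = le (3 * s) (eq s t)
    where
    eq : ∀ s t → 1 * (s + t + s) + 3 * s ≡ 4 * (0 * (s + t) + s) + (s + t)
    eq = solve-∀
  go 1 _ = le (5 * s + 3 * t) (eq s t)
    where
    eq : ∀ s t → 2 * (s + t + s) + (5 * s + 3 * t) ≡ 4 * (1 * (s + t) + s) + (s + t)
    eq = solve-∀
  go 2 _ = le (5 * s + 5 * t) (eq s t)
    where
    eq : ∀ s t → 4 * (s + t + s) + (5 * s + 5 * t) ≡ 4 * (2 * (s + t) + s) + (s + t)
    eq = solve-∀
  go 3 _ = le (s + 5 * t) (eq s t)
    where
    eq : ∀ s t → 8 * (s + t + s) + (s + 5 * t) ≡ 4 * (3 * (s + t) + s) + (s + t)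
    eq = solve-∀
  go (suc (suc (suc (suc _)))) (s≤s (s≤s (s≤s ())))

c≤4m : ∀ {c m n k} q {s} → s ≤ k → n ≡ q * k + s → c + k ≡ 2 ^ q * (k + s) → n ≤ m →
       8 * (2 ^ q * (k + s)) ≤ 27 * (m + k) → c ≤ 4 * m
c≤4m {c} {m} {n} {k} q {s} s≤k n≡ c≡ n≤m bound with ≤-<-connex q 3
... | inj₁ q≤3 = +-cancelʳ-≤ k c (4 * m) (begin
  c + k                ≡⟨ c≡ ⟩
  2 ^ q * (k + s)      ≤⟨ 2^q*[k+s]≤4*[qk+s]+k q q≤3 k s s≤k ⟩
  4 * (q * k + s) + k  ≡⟨ cong (λ z → 4 * z + k) n≡ ⟨
  4 * n + k            ≤⟨ +-monoˡ-≤ k (*-monoʳ-≤ 4 n≤m) ⟩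
  4 * m + k            ∎)
  where open ≤-Reasoning
... | inj₂ 4≤q = *-cancelˡ-≤ 8 (+-cancelʳ-≤ (8 * k) (8 * c) (8 * (4 * m)) (begin
  8 * c + 8 * k                ≡⟨ *-distribˡ-+ 8 c k ⟨
  8 * (c + k)                  ≡⟨ cong (8 *_) c≡ ⟩
  8 * (2 ^ q * (k + s))        ≤⟨ bound ⟩
  -- The extra `k` makes the surplus over `8 * k` equal to 20 k = 5 * (4 k), at most `5 * m`; then
  -- 27 + 5 = 8 * 4.
  27 * (m + k)                 ≤⟨ m≤m+n _ k ⟩
  27 * (m + k) + k             ≡⟨ eq₁ m k ⟩
  27 * m + 5 * (4 * k) + 8 * k ≤⟨ +-monoˡ-≤ (8 * k) (+-monoʳ-≤ (27 * m) (*-monoʳ-≤ 5 4k≤m)) ⟩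
  27 * m + 5 * m + 8 * k       ≡⟨ eq₂ m k ⟩
  8 * (4 * m) + 8 * k          ∎))
  where
  open ≤-Reasoning
  4k≤m : 4 * k ≤ m
  4k≤m = begin
    4 * k      ≤⟨ *-monoˡ-≤ k 4≤q ⟩
    q * k      ≤⟨ m≤m+n _ s ⟩
    q * k + s  ≡⟨ n≡ ⟨
    n          ≤⟨ n≤m ⟩
    m          ∎
  eq₁ : ∀ m k → 27 * (m + k) + k ≡ 27 * m + 5 * (4 * k) + 8 * k
  eq₁ = solve-∀
  eq₂ : ∀ m k → 27 * m + 5 * m + 8 * k ≡ 8 * (4 * m) + 8 * k
  eq₂ = solve-∀

-- Adding `2 * k` to `n` raises `q` by 2, so the factor 8 becomes 32, which exceeds 27.
c≤m : ∀ {c m} k q {s} → c + k ≡ 2 ^ q * (k + s) →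
      8 * (2 ^ (2 + q) * (k + s)) ≤ 27 * (m + k) → c ≤ m
c≤m {c} {m} k q {s} c≡ bound = +-cancelʳ-≤ k c m (*-cancelˡ-≤ 32 (begin
  32 * (c + k)                ≡⟨ cong (32 *_) c≡ ⟩
  32 * (2 ^ q * (k + s))      ≡⟨ eq (2 ^ q) (k + s) ⟩
  8 * (2 ^ (2 + q) * (k + s)) ≤⟨ bound ⟩
  27 * (m + k)                ≤⟨ *-monoˡ-≤ (m + k) (m≤m+n 27 5) ⟩
  32 * (m + k)                ∎))
  where
  open ≤-Reasoning
  eq : ∀ a b → 32 * (a * b) ≡ 8 * (2 * (2 * a) * b)
  eq = solve-∀

-- No with-abstraction here: it would normalise opt, which is a brute-force search.
constr≤4*opt : ∀ n k .{{_ : NonZero n}} .{{_ : NonZero k}} → constr n k ≤ 4 * opt n k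
constr≤4*opt n k =
  let q , s , s≤k , n≡ , c≡ = constr-form n k
  in c≤4m q s≤k n≡ c≡ (n≤opt n k) (8*2^q*[k+s]≤27*[opt+k] n k q s≤k n≡)

constr≤opt[n+2k] : ∀ n k .{{_ : NonZero n}} .{{_ : NonZero k}} → constr n k ≤ opt (n + 2 * k) k
constr≤opt[n+2k] n k =
  let q , s , s≤k , n≡ , c≡ = constr-form n k
  in c≤m k q c≡ (8*2^q*[k+s]≤27*[opt+k] (n + 2 * k) k (2 + q) s≤k
       (trans (cong (_+ 2 * k) n≡) (eq q k s)))
  where
  eq : ∀ q k s → q * k + s + 2 * k ≡ (2 + q) * k + s
  eq = solve-∀

mainTheorem6 : (n k : ℕ) .{{_ : NonZero n}} .{{_ : NonZero k}} →
    (constr n k ≤ 4 * opt n k) × (constr n k ≤ opt (n + 2 * k) k)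
mainTheorem6 n k = constr≤4*opt n k , constr≤opt[n+2k] n k
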